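{- Let $\mathfrak U$ be a Grothendieck universe and let $T_{\mathrm{Ab}}$ be the theory of commutative groups in the language $(+,-,0)$. The category $\mathbb{M}\mathrm{od}_{\mathfrak U}(T_{\mathrm{Ab}})$ of Abelian groups whose underlying set belongs to $\mathfrak U$ (with all group homomorphisms as morphisms) is universal: every small category that is $L_{\mathrm{cat}}$-elementarily equivalent to $\mathbb{M}\mathrm{od}_{\mathfrak U}(T_{\mathrm{Ab}})$ embeds in it.
   Context: A Grothendieck universe is a set $\mathfrak U$ that is transitive, closed under power sets, closed under unions $\bigcup_{i\in I}x_i$ with $I\in\mathfrak U$ and all $x_i\in\mathfrak U$, and contains $\omega$. $L_{\mathrm{cat}}$ is the two-sorted language with an object sort and a morphism sort, a binary (partial) function $\circ$ on morphisms (composition), unary functions dom and rng from morphisms to objects, and a unary function Id from objects to morphisms (identity morphism). Composition is regarded as a partial function, defined only on composable pairs (equivalently, one uses its graph as a ternary relation). Every category is an $L_{\mathrm{cat}}$-structure. A category is small if both its set of objects and its set of morphisms are elements of $\mathfrak U$. An embedding of categories is a functor that is injective on objects and on morphisms. A structure whose underlying set is a subset of $\mathfrak U$ is universal if every small structure elementarily equivalent to it embeds in it. -}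

module Defs where

open import Level using (Level; _⊔_; Lift; lift) renaming (suc to lsuc)
open import Algebra.Bundles using (AbelianGroup)
open import Algebra.Bundles.Raw using (RawGroup)
open import Algebra.Structures using (IsAbelianGroup)
open import Algebra.Morphism.Structures using (IsGroupHomomorphism)
open import Data.Empty using (⊥)
open import Data.List.Base using (List; []; _∷_)
open import Data.List.Relation.Unary.All using (All; []; _∷_; lookup)
import Data.List.Membership.Propositional as List
open import Data.Nat.Base using (ℕ; zero; suc)
open import Data.Product.Base using (Σ; Σ-syntax; ∃-syntax; _×_; _,_; proj₁; proj₂)
open import Data.Sum.Base using (_⊎_; inj₁; inj₂; [_,_]′)
open import Data.Unit.Base using (⊤; tt)
open import Function.Base using (id; _∘_)
open import Function.Bundles using (Func; _⇔_)
open import Function.Definitions using (Injective)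
open import Relation.Binary.Bundles using (Setoid)

private variable
  ℓ c r c₁ r₁ c₂ r₂ : Level

------------------------------------------------------------------------
-- Sets

-- The cumulative hierarchy of Aczel: a set is a family of sets, and two
-- families are the same set when they have the same members.  Under
-- excluded middle this is a model of ZF, and it plays the role of the
-- universe of all sets.

data V (ℓ : Level) : Set (lsuc ℓ) where
  sup : (I : Set ℓ) → (I → V ℓ) → V ℓ

Idx : V ℓ → Set ℓ
Idx (sup I _) = I

elt : (x : V ℓ) → Idx x → V ℓ
elt (sup _ f) = f

infix 4 _≈_ _∈_ _⊆_

_≈_ : V ℓ → V ℓ → Set ℓ
sup I f ≈ sup J g =
  (∀ i → Σ[ j ∈ J ] f i ≈ g j) × (∀ j → Σ[ i ∈ I ] f i ≈ g j)

_∈_ : V ℓ → V ℓ → Set ℓ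
x ∈ y = Σ[ j ∈ Idx y ] x ≈ elt y j

_⊆_ : V ℓ → V ℓ → Set (lsuc ℓ)
x ⊆ y = ∀ z → z ∈ x → z ∈ y

≈-refl : (x : V ℓ) → x ≈ x
≈-refl (sup I f) = (λ i → i , ≈-refl (f i)) , (λ i → i , ≈-refl (f i))

≈-sym : (x y : V ℓ) → x ≈ y → y ≈ x
≈-sym (sup I f) (sup J g) (p , q) =
  (λ j → proj₁ (q j) , ≈-sym (f (proj₁ (q j))) (g j) (proj₂ (q j))) ,
  (λ i → proj₁ (p i) , ≈-sym (f i) (g (proj₁ (p i))) (proj₂ (p i)))

≈-trans : (x y z : V ℓ) → x ≈ y → y ≈ z → x ≈ z
≈-trans (sup I f) (sup J g) (sup K h) (p , q) (p′ , q′) =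
  (λ i → let j , e = p i ; k , e′ = p′ j in
         k , ≈-trans (f i) (g j) (h k) e e′) ,
  (λ k → let j , e′ = q′ k ; i , e = q j in
         i , ≈-trans (f i) (g j) (h k) e e′)

≈⇒elt : (x y : V ℓ) → x ≈ y → ∀ i → Σ[ j ∈ Idx y ] elt x i ≈ elt y j
≈⇒elt (sup _ _) (sup _ _) = proj₁

-- Same element, named by indices of possibly different sets.
SameElt : (x y : V ℓ) → Idx x → Idx y → Set ℓ
SameElt x y i j = elt x i ≈ elt y j

-- The elements of x, as a setoid.
El : V ℓ → Setoid ℓ ℓ
El x = record
  { Carrier       = Idx x
  ; _≈_           = SameElt x x
  ; isEquivalence = record
    { refl  = λ {i} → ≈-refl (elt x i)
    ; sym   = λ {i} {j} → ≈-sym (elt x i) (elt x j)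
    ; trans = λ {i} {j} {k} → ≈-trans (elt x i) (elt x j) (elt x k)
    }
  }

∅ : V ℓ
∅ {ℓ} = sup (Lift ℓ ⊥) λ ()

_⁺ : V ℓ → V ℓ
_⁺ {ℓ} x = sup (Idx x ⊎ ⊤) [ elt x , (λ _ → x) ]′

ω : V ℓ
ω {ℓ} = sup (Lift ℓ ℕ) λ { (lift n) → numeral n }
  where
  numeral : ℕ → V ℓ
  numeral zero    = ∅
  numeral (suc n) = numeral n ⁺

⋃ : (I : V ℓ) → (Idx I → V ℓ) → V ℓ
⋃ I x = sup (Σ[ i ∈ Idx I ] Idx (x i)) λ { (i , j) → elt (x i) j }

IsPowerSet : V ℓ → V ℓ → Set (lsuc ℓ)
IsPowerSet p x = ∀ z → z ∈ p ⇔ z ⊆ x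

record IsGrothendieckUniverse (𝔘 : V ℓ) : Set (lsuc ℓ) where
  field
    transitive  : ∀ x → x ∈ 𝔘 → x ⊆ 𝔘
    -- Without excluded middle V need not have power sets, so the power
    -- set is asserted to exist in 𝔘 rather than constructed.
    power       : ∀ x → x ∈ 𝔘 → ∃[ p ] IsPowerSet p x × p ∈ 𝔘
    -- The second premise on x says that it is a family indexed by the
    -- elements of I, not merely by their names.
    union       : ∀ I → I ∈ 𝔘 → (x : Idx I → V ℓ) →
                  (∀ i j → elt I i ≈ elt I j → x i ≈ x j) →
                  (∀ i → x i ∈ 𝔘) → ⋃ I x ∈ 𝔘
    ω∈𝔘         : ω ∈ 𝔘

------------------------------------------------------------------------
-- The language of categories

data Sort : Set where
  ‵ob ‵mor : Sort

-- Variables are positions in the list of the sorts in scope.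
data Term (Γ : List Sort) : Sort → Set where
  var       : ∀ {s} → s List.∈ Γ → Term Γ s
  ‵dom ‵rng : Term Γ ‵mor → Term Γ ‵ob
  ‵Id       : Term Γ ‵ob → Term Γ ‵mor

infix 6 _≐_
infixr 5 _∧_
infixr 4 _∨_
infixr 3 _⇒_

data Formula (Γ : List Sort) : Set where
  _≐_         : ∀ {s} → Term Γ s → Term Γ s → Formula Γ
  -- The graph of composition: ‵comp g f h reads g ∘ f = h.
  ‵comp       : (g f h : Term Γ ‵mor) → Formula Γ
  false       : Formula Γ
  _∧_ _∨_ _⇒_ : Formula Γ → Formula Γ → Formula Γ
  all ex      : ∀ s → Formula (s ∷ Γ) → Formula Γ

Sentence : Set
Sentence = Formula []

record LCatStructure (c r : Level) : Set (lsuc (c ⊔ r)) where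
  field
    Obj Mor   : Setoid c r
    dom rng   : Func Mor Obj
    Id        : Func Obj Mor

  module Obj = Setoid Obj
  module Mor = Setoid Mor
  open Func dom public using () renaming (to to dom₀; cong to dom-cong)
  open Func rng public using () renaming (to to rng₀; cong to rng-cong)
  open Func Id  public using () renaming (to to Id₀;  cong to Id-cong)

  field
    -- Comp g f h: the composite g ∘ f is defined and equals h.
    Comp      : (g f h : Mor.Carrier) → Set r
    Comp-resp : ∀ {g g′ f f′ h h′} → g Mor.≈ g′ → f Mor.≈ f′ → h Mor.≈ h′ →
                Comp g f h → Comp g′ f′ h′

module Semantics (S : LCatStructure c r) where
  open LCatStructure S using (Obj; Mor; dom₀; rng₀; Id₀; Comp)

  sort : Sort → Setoid c r
  sort ‵ob  = Obj
  sort ‵mor = Mor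

  Env : List Sort → Set c
  Env = All (λ s → Setoid.Carrier (sort s))

  ⟦_⟧ : ∀ {Γ s} → Term Γ s → Env Γ → Setoid.Carrier (sort s)
  ⟦ var x ⟧  ρ = lookup ρ x
  ⟦ ‵dom t ⟧ ρ = dom₀ (⟦ t ⟧ ρ)
  ⟦ ‵rng t ⟧ ρ = rng₀ (⟦ t ⟧ ρ)
  ⟦ ‵Id t ⟧  ρ = Id₀ (⟦ t ⟧ ρ)

  Sat : ∀ {Γ} → Formula Γ → Env Γ → Set (c ⊔ r)
  Sat (_≐_ {s} t u) ρ = Lift c (Setoid._≈_ (sort s) (⟦ t ⟧ ρ) (⟦ u ⟧ ρ))
  Sat (‵comp g f h) ρ = Lift c (Comp (⟦ g ⟧ ρ) (⟦ f ⟧ ρ) (⟦ h ⟧ ρ))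
  Sat false         ρ = Lift (c ⊔ r) ⊥
  Sat (φ ∧ ψ)       ρ = Sat φ ρ × Sat ψ ρ
  Sat (φ ∨ ψ)       ρ = Sat φ ρ ⊎ Sat ψ ρ
  Sat (φ ⇒ ψ)       ρ = Sat φ ρ → Sat ψ ρ
  Sat (all s φ)     ρ = ∀ x → Sat φ (x ∷ ρ)
  Sat (ex s φ)      ρ = ∃[ x ] Sat φ (x ∷ ρ)

infix 4 _⊨_ _≡ₑ_

_⊨_ : LCatStructure c r → Sentence → Set (c ⊔ r)
S ⊨ φ = Semantics.Sat S φ []

_≡ₑ_ : LCatStructure c₁ r₁ → LCatStructure c₂ r₂ → Set (c₁ ⊔ r₁ ⊔ c₂ ⊔ r₂)
S ≡ₑ T = ∀ φ → (S ⊨ φ) ⇔ (T ⊨ φ)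

------------------------------------------------------------------------
-- Categories

record IsCategory (S : LCatStructure c r) : Set (c ⊔ r) where
  open LCatStructure S
  field
    composable : ∀ {g f h} → Comp g f h → rng₀ f Obj.≈ dom₀ g
    composite  : ∀ {g f} → rng₀ f Obj.≈ dom₀ g → ∃[ h ] Comp g f h
    functional : ∀ {g f h h′} → Comp g f h → Comp g f h′ → h Mor.≈ h′
    dom-comp   : ∀ {g f h} → Comp g f h → dom₀ h Obj.≈ dom₀ f
    rng-comp   : ∀ {g f h} → Comp g f h → rng₀ h Obj.≈ rng₀ g
    dom-Id     : ∀ x → dom₀ (Id₀ x) Obj.≈ x
    rng-Id     : ∀ x → rng₀ (Id₀ x) Obj.≈ x
    identityˡ  : ∀ f → Comp (Id₀ (rng₀ f)) f f
    identityʳ  : ∀ f → Comp f (Id₀ (dom₀ f)) f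
    -- h ∘ (g ∘ f) = (h ∘ g) ∘ f
    assoc      : ∀ {f g h gf hg k} → Comp g f gf → Comp h g hg →
                 Comp h gf k → Comp hg f k

record Category (c r : Level) : Set (lsuc (c ⊔ r)) where
  field
    structure  : LCatStructure c r
    isCategory : IsCategory structure
  open LCatStructure structure public
  open IsCategory isCategory public

record Functor (C : Category c₁ r₁) (D : Category c₂ r₂) :
               Set (c₁ ⊔ r₁ ⊔ c₂ ⊔ r₂) where
  private
    module C = Category C
    module D = Category D
  field
    onObj : Func C.Obj D.Obj
    onMor : Func C.Mor D.Mor
  open Func onObj public using () renaming (to to F₀; cong to F₀-cong)
  open Func onMor public using () renaming (to to F₁; cong to F₁-cong)
  field
    F-dom  : ∀ f → D.dom₀ (F₁ f) D.Obj.≈ F₀ (C.dom₀ f)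
    F-rng  : ∀ f → D.rng₀ (F₁ f) D.Obj.≈ F₀ (C.rng₀ f)
    F-Id   : ∀ x → F₁ (C.Id₀ x) D.Mor.≈ D.Id₀ (F₀ x)
    F-Comp : ∀ {g f h} → C.Comp g f h → D.Comp (F₁ g) (F₁ f) (F₁ h)

record Embedding (C : Category c₁ r₁) (D : Category c₂ r₂) :
                 Set (c₁ ⊔ r₁ ⊔ c₂ ⊔ r₂) where
  private
    module C = Category C
    module D = Category D
  field
    functor : Functor C D
  open Functor functor public
  field
    F₀-injective : Injective C.Obj._≈_ D.Obj._≈_ F₀
    F₁-injective : Injective C.Mor._≈_ D.Mor._≈_ F₁

record SmallCategory (𝔘 : V ℓ) : Set (lsuc ℓ) where
  field
    obj mor   : V ℓ
    obj∈𝔘     : obj ∈ 𝔘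
    mor∈𝔘     : mor ∈ 𝔘
    dom rng   : Func (El mor) (El obj)
    Id        : Func (El obj) (El mor)
    Comp      : (g f h : Idx mor) → Set ℓ
    Comp-resp : ∀ {g g′ f f′ h h′} → SameElt mor mor g g′ →
                SameElt mor mor f f′ → SameElt mor mor h h′ →
                Comp g f h → Comp g′ f′ h′

  structure : LCatStructure ℓ ℓ
  structure = record
    { Obj = El obj ; Mor = El mor ; dom = dom ; rng = rng ; Id = Id
    ; Comp = Comp ; Comp-resp = Comp-resp }

  field
    isCategory : IsCategory structure

  category : Category ℓ ℓ
  category = record { structure = structure ; isCategory = isCategory }

Universal : V ℓ → Category c r → Set (lsuc ℓ ⊔ c ⊔ r)
Universal 𝔘 M = (C : SmallCategory 𝔘) →
  SmallCategory.structure C ≡ₑ Category.structure M →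
  Embedding (SmallCategory.category C) M

------------------------------------------------------------------------
-- Abelian groups with underlying set in 𝔘

module _ (𝔘 : V ℓ) where

  record AbGroup : Set (lsuc ℓ) where
    infixl 6 _+_
    field
      set            : V ℓ
      set∈𝔘          : set ∈ 𝔘
      _+_            : Idx set → Idx set → Idx set
      0#             : Idx set
      -_             : Idx set → Idx set
      isAbelianGroup : IsAbelianGroup (SameElt set set) _+_ 0# -_

    abelianGroup : AbelianGroup ℓ ℓ
    abelianGroup = record { isAbelianGroup = isAbelianGroup }

    rawGroup : RawGroup ℓ ℓ
    rawGroup = AbelianGroup.rawGroup abelianGroup

    open AbelianGroup abelianGroup public
      using (refl; sym; trans; ∙-cong; ⁻¹-cong)

  -- Equality of the tuples (A, +, -, 0), not isomorphism.
  record _≈ᴳ_ (G H : AbGroup) : Set ℓ where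
    private
      module G = AbGroup G
      module H = AbGroup H
      _~_ = SameElt G.set H.set
    field
      set≈ : G.set ≈ H.set
      +≈   : ∀ {i i′ j j′} → i ~ i′ → j ~ j′ → (i G.+ j) ~ (i′ H.+ j′)
      -≈   : ∀ {i i′} → i ~ i′ → (G.- i) ~ (H.- i′)
      0≈   : G.0# ~ H.0#

  -- A homomorphism together with its domain and codomain.
  record AbHom : Set (lsuc ℓ) where
    field
      dom cod : AbGroup
    module dom = AbGroup dom
    module cod = AbGroup cod
    field
      fun    : Idx dom.set → Idx cod.set
      isHom  : IsGroupHomomorphism dom.rawGroup cod.rawGroup fun
    open IsGroupHomomorphism isHom public

  record _≈ᴹ_ (f g : AbHom) : Set ℓ where
    private
      module f = AbHom f
      module g = AbHom g
    field
      dom≈ : f.dom ≈ᴳ g.dom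
      cod≈ : f.cod ≈ᴳ g.cod
      fun≈ : ∀ {i i′} → SameElt f.dom.set g.dom.set i i′ →
             SameElt f.cod.set g.cod.set (f.fun i) (g.fun i′)

  -- h is the composite of f followed by g; k is f(i) seen as an element
  -- of the domain of g.
  record AbComp (g f h : AbHom) : Set ℓ where
    private
      module f = AbHom f
      module g = AbHom g
      module h = AbHom h
    field
      composable : f.cod ≈ᴳ g.dom
      dom≈       : h.dom ≈ᴳ f.dom
      cod≈       : h.cod ≈ᴳ g.cod
      fun≈       : ∀ {i i′ k} → SameElt h.dom.set f.dom.set i i′ →
                   SameElt f.cod.set g.dom.set (f.fun i′) k →
                   SameElt h.cod.set g.cod.set (h.fun i) (g.fun k)

  private
    S : (x y : V ℓ) → Idx x → Idx y → Set ℓ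
    S = SameElt

    S-sym : ∀ x y {i j} → S x y i j → S y x j i
    S-sym x y {i} {j} = ≈-sym (elt x i) (elt y j)

    S-trans : ∀ x y z {i j k} → S x y i j → S y z j k → S x z i k
    S-trans x y z {i} {j} {k} = ≈-trans (elt x i) (elt y j) (elt z k)

    S-refl : ∀ x {i} → S x x i i
    S-refl x {i} = ≈-refl (elt x i)

    set : AbGroup → V ℓ
    set = AbGroup.set

  ≈ᴳ-refl : ∀ G → G ≈ᴳ G
  ≈ᴳ-refl G = record
    { set≈ = ≈-refl G.set
    ; +≈   = G.∙-cong
    ; -≈   = G.⁻¹-cong
    ; 0≈   = S-refl G.set
    }
    where module G = AbGroup G

  ≈ᴳ-sym : ∀ G H → G ≈ᴳ H → H ≈ᴳ G
  ≈ᴳ-sym G H e = record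
    { set≈ = ≈-sym A B e.set≈
    ; +≈   = λ p q → S-sym A B (e.+≈ (S-sym B A p) (S-sym B A q))
    ; -≈   = λ p → S-sym A B (e.-≈ (S-sym B A p))
    ; 0≈   = S-sym A B e.0≈
    }
    where
    module e = _≈ᴳ_ e
    A = set G
    B = set H

  ≈ᴳ-trans : ∀ G H K → G ≈ᴳ H → H ≈ᴳ K → G ≈ᴳ K
  ≈ᴳ-trans G H K d e = record
    { set≈ = ≈-trans A B C d.set≈ e.set≈
    ; +≈   = λ {i} {i′} {j} {j′} p q →
        let i₁ , p₁ = mid i ; j₁ , q₁ = mid j in
        S-trans A B C (d.+≈ p₁ q₁)
          (e.+≈ (S-trans B A C (S-sym A B p₁) p)
                (S-trans B A C (S-sym A B q₁) q))
    ; -≈   = λ {i} p →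
        let i₁ , p₁ = mid i in
        S-trans A B C (d.-≈ p₁) (e.-≈ (S-trans B A C (S-sym A B p₁) p))
    ; 0≈   = S-trans A B C d.0≈ e.0≈
    }
    where
    module d = _≈ᴳ_ d
    module e = _≈ᴳ_ e
    A = set G
    B = set H
    C = set K
    mid = ≈⇒elt A B d.set≈

  ≈ᴹ-refl : ∀ f → f ≈ᴹ f
  ≈ᴹ-refl f = record
    { dom≈ = ≈ᴳ-refl f.dom
    ; cod≈ = ≈ᴳ-refl f.cod
    ; fun≈ = f.⟦⟧-cong
    }
    where module f = AbHom f

  ≈ᴹ-sym : ∀ f g → f ≈ᴹ g → g ≈ᴹ f
  ≈ᴹ-sym f g e = record
    { dom≈ = ≈ᴳ-sym f.dom g.dom e.dom≈
    ; cod≈ = ≈ᴳ-sym f.cod g.cod e.cod≈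
    ; fun≈ = λ p → S-sym f.cod.set g.cod.set
                     (e.fun≈ (S-sym g.dom.set f.dom.set p))
    }
    where
    module f = AbHom f
    module g = AbHom g
    module e = _≈ᴹ_ e

  ≈ᴹ-trans : ∀ f g h → f ≈ᴹ g → g ≈ᴹ h → f ≈ᴹ h
  ≈ᴹ-trans f g h d e = record
    { dom≈ = ≈ᴳ-trans f.dom g.dom h.dom d.dom≈ e.dom≈
    ; cod≈ = ≈ᴳ-trans f.cod g.cod h.cod d.cod≈ e.cod≈
    ; fun≈ = λ {i} p →
        let j , q = ≈⇒elt f.dom.set g.dom.set (_≈ᴳ_.set≈ d.dom≈) i in
        S-trans f.cod.set g.cod.set h.cod.set (d.fun≈ q)
          (e.fun≈ (S-trans g.dom.set f.dom.set h.dom.set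
                    (S-sym f.dom.set g.dom.set q) p))
    }
    where
    module f = AbHom f
    module g = AbHom g
    module h = AbHom h
    module d = _≈ᴹ_ d
    module e = _≈ᴹ_ e

  AbObj : Setoid (lsuc ℓ) ℓ
  AbObj = record
    { Carrier       = AbGroup
    ; _≈_           = _≈ᴳ_
    ; isEquivalence = record
      { refl  = λ {G} → ≈ᴳ-refl G
      ; sym   = λ {G} {H} → ≈ᴳ-sym G H
      ; trans = λ {G} {H} {K} → ≈ᴳ-trans G H K
      }
    }

  AbMor : Setoid (lsuc ℓ) ℓ
  AbMor = record
    { Carrier       = AbHom
    ; _≈_           = _≈ᴹ_
    ; isEquivalence = record
      { refl  = λ {f} → ≈ᴹ-refl f
      ; sym   = λ {f} {g} → ≈ᴹ-sym f g
      ; trans = λ {f} {g} {h} → ≈ᴹ-trans f g h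
      }
    }

  -- Equal groups G and H have an identity homomorphism G → H.
  ≈ᴳ⇒hom : ∀ G H → G ≈ᴳ H → AbHom
  ≈ᴳ⇒hom G H e = record
    { dom   = G
    ; cod   = H
    ; fun   = λ i → proj₁ (to i)
    ; isHom = record
      { isMonoidHomomorphism = record
        { isMagmaHomomorphism = record
          { isRelHomomorphism = record
            { cong = λ {i} {j} p → back i (S-trans A A B p (proj₂ (to j))) }
          ; homo = λ i j → back (i G.+ j)
                             (e.+≈ (proj₂ (to i)) (proj₂ (to j)))
          }
        ; ε-homo = back G.0# e.0≈
        }
      ; ⁻¹-homo = λ i → back (G.- i) (e.-≈ (proj₂ (to i)))
      }
    }
    where
    module G = AbGroup G
    module H = AbGroup H
    module e = _≈ᴳ_ e
    A = set G
    B = set H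
    to = ≈⇒elt A B e.set≈
    back : ∀ i {k} → S A B i k → S B B (proj₁ (to i)) k
    back i = S-trans B A B (S-sym A B (proj₂ (to i)))

  idHom : AbGroup → AbHom
  idHom G = record
    { dom   = G
    ; cod   = G
    ; fun   = id
    ; isHom = record
      { isMonoidHomomorphism = record
        { isMagmaHomomorphism = record
          { isRelHomomorphism = record { cong = id }
          ; homo = λ _ _ → S-refl (set G)
          }
        ; ε-homo = S-refl (set G)
        }
      ; ⁻¹-homo = λ _ → S-refl (set G)
      }
    }

  compHom : ∀ g f → AbHom.cod f ≈ᴳ AbHom.dom g → AbHom
  compHom g f e = record
    { dom   = f.dom
    ; cod   = g.cod
    ; fun   = λ i → g.fun (t.fun (f.fun i))
    ; isHom = record
      { isMonoidHomomorphism = record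
        { isMagmaHomomorphism = record
          { isRelHomomorphism = record
            { cong = g.⟦⟧-cong ∘ t.⟦⟧-cong ∘ f.⟦⟧-cong }
          ; homo = λ i j →
              g.cod.trans (g.⟦⟧-cong (g.dom.trans (t.⟦⟧-cong (f.homo i j))
                                                  (t.homo _ _)))
                          (g.homo _ _)
          }
        ; ε-homo = g.cod.trans (g.⟦⟧-cong (g.dom.trans (t.⟦⟧-cong f.ε-homo)
                                                       t.ε-homo))
                               g.ε-homo
        }
      ; ⁻¹-homo = λ i →
          g.cod.trans (g.⟦⟧-cong (g.dom.trans (t.⟦⟧-cong (f.⁻¹-homo i))
                                              (t.⁻¹-homo _)))
                      (g.⁻¹-homo _)
      }
    }
    where
    module f = AbHom f
    module g = AbHom g
    module t = AbHom (≈ᴳ⇒hom f.cod g.dom e)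

  AbStructure : LCatStructure (lsuc ℓ) ℓ
  AbStructure = record
    { Obj  = AbObj
    ; Mor  = AbMor
    ; dom  = record { to = AbHom.dom ; cong = _≈ᴹ_.dom≈ }
    ; rng  = record { to = AbHom.cod ; cong = _≈ᴹ_.cod≈ }
    ; Id   = record { to = idHom ; cong = λ e → record
               { dom≈ = e ; cod≈ = e ; fun≈ = id } }
    ; Comp = AbComp
    ; Comp-resp = λ {g} {g′} {f} {f′} {h} {h′} → resp g g′ f f′ h h′
    }
    where
    resp : ∀ g g′ f f′ h h′ → g ≈ᴹ g′ → f ≈ᴹ f′ → h ≈ᴹ h′ →
           AbComp g f h → AbComp g′ f′ h′
    resp g g′ f f′ h h′ eg ef eh k = record
      { composable = ≈ᴳ-trans f′.cod f.cod g′.dom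
          (≈ᴳ-sym f.cod f′.cod ef.cod≈)
          (≈ᴳ-trans f.cod g.dom g′.dom k.composable eg.dom≈)
      ; dom≈ = ≈ᴳ-trans h′.dom h.dom f′.dom (≈ᴳ-sym h.dom h′.dom eh.dom≈)
          (≈ᴳ-trans h.dom f.dom f′.dom k.dom≈ ef.dom≈)
      ; cod≈ = ≈ᴳ-trans h′.cod h.cod g′.cod (≈ᴳ-sym h.cod h′.cod eh.cod≈)
          (≈ᴳ-trans h.cod g.cod g′.cod k.cod≈ eg.cod≈)
      ; fun≈ = λ {i} {i′} {j} p q →
          let i₀ , a = ≈⇒elt h′.dom.set h.dom.set
                 (≈-sym h.dom.set h′.dom.set (_≈ᴳ_.set≈ eh.dom≈)) i
              a′ = S-sym h′.dom.set h.dom.set a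
              i₁ , b = ≈⇒elt h.dom.set f.dom.set (_≈ᴳ_.set≈ k.dom≈) i₀
              j₀ , d = ≈⇒elt f.cod.set g.dom.set
                 (_≈ᴳ_.set≈ k.composable) (f.fun i₁)
              u = S-trans f.dom.set h.dom.set f′.dom.set
                    (S-sym h.dom.set f.dom.set b)
                    (S-trans h.dom.set h′.dom.set f′.dom.set a′ p)
              v = S-trans g.dom.set f.cod.set g′.dom.set
                    (S-sym f.cod.set g.dom.set d)
                    (S-trans f.cod.set f′.cod.set g′.dom.set (ef.fun≈ u) q)
          in S-trans h′.cod.set h.cod.set g′.cod.set
               (S-sym h.cod.set h′.cod.set (eh.fun≈ a′))
               (S-trans h.cod.set g.cod.set g′.cod.set
                 (k.fun≈ b d) (eg.fun≈ v))
      }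
      where
      module g = AbHom g
      module g′ = AbHom g′
      module f = AbHom f
      module f′ = AbHom f′
      module h = AbHom h
      module h′ = AbHom h′
      module eg = _≈ᴹ_ eg
      module ef = _≈ᴹ_ ef
      module eh = _≈ᴹ_ eh
      module k = AbComp k

  private
    comp-compHom : ∀ g f e → AbComp g f (compHom g f e)
    comp-compHom g f e = record
      { composable = e
      ; dom≈ = ≈ᴳ-refl f.dom
      ; cod≈ = ≈ᴳ-refl g.cod
      ; fun≈ = λ {i} {i′} {k} p q → g.⟦⟧-cong
          (S-trans g.dom.set f.cod.set g.dom.set
            (S-sym f.cod.set g.dom.set
              (proj₂ (≈⇒elt f.cod.set g.dom.set (_≈ᴳ_.set≈ e) (f.fun i))))
            (S-trans f.cod.set f.cod.set g.dom.set (f.⟦⟧-cong p) q))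
      }
      where
      module f = AbHom f
      module g = AbHom g

    comp-functional : ∀ g f h h′ → AbComp g f h → AbComp g f h′ → h ≈ᴹ h′
    comp-functional g f h h′ a b = record
      { dom≈ = ≈ᴳ-trans h.dom f.dom h′.dom a.dom≈
                 (≈ᴳ-sym h′.dom f.dom b.dom≈)
      ; cod≈ = ≈ᴳ-trans h.cod g.cod h′.cod a.cod≈
                 (≈ᴳ-sym h′.cod g.cod b.cod≈)
      ; fun≈ = λ {i} {i′} p →
          let j , q = ≈⇒elt h.dom.set f.dom.set (_≈ᴳ_.set≈ a.dom≈) i
              k , r = ≈⇒elt f.cod.set g.dom.set
                        (_≈ᴳ_.set≈ a.composable) (f.fun j)
          in S-trans h.cod.set g.cod.set h′.cod.set (a.fun≈ q r)
               (S-sym h′.cod.set g.cod.set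
                 (b.fun≈ (S-trans h′.dom.set h.dom.set f.dom.set
                           (S-sym h.dom.set h′.dom.set p) q) r))
      }
      where
      module f = AbHom f
      module g = AbHom g
      module h = AbHom h
      module h′ = AbHom h′
      module a = AbComp a
      module b = AbComp b

    comp-assoc : ∀ f g h gf hg k → AbComp g f gf → AbComp h g hg →
                 AbComp h gf k → AbComp hg f k
    comp-assoc f g h gf hg k a b d = record
      { composable = ≈ᴳ-trans f.cod g.dom hg.dom a.composable
                       (≈ᴳ-sym hg.dom g.dom b.dom≈)
      ; dom≈ = ≈ᴳ-trans k.dom gf.dom f.dom d.dom≈ a.dom≈
      ; cod≈ = ≈ᴳ-trans k.cod h.cod hg.cod d.cod≈
                 (≈ᴳ-sym hg.cod h.cod b.cod≈)
      ; fun≈ = λ {i} {i′} {j} p q →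
          let i₁ , u = ≈⇒elt k.dom.set gf.dom.set (_≈ᴳ_.set≈ d.dom≈) i
              m , v = ≈⇒elt hg.dom.set g.dom.set (_≈ᴳ_.set≈ b.dom≈) j
              n , w = ≈⇒elt g.cod.set h.dom.set
                        (_≈ᴳ_.set≈ b.composable) (g.fun m)
              x = a.fun≈ (S-trans gf.dom.set k.dom.set f.dom.set
                           (S-sym k.dom.set gf.dom.set u) p)
                         (S-trans f.cod.set hg.dom.set g.dom.set q v)
          in S-trans k.cod.set h.cod.set hg.cod.set
               (d.fun≈ u (S-trans gf.cod.set g.cod.set h.dom.set x w))
               (S-sym hg.cod.set h.cod.set (b.fun≈ v w))
      }
      where
      module f = AbHom f
      module g = AbHom g
      module h = AbHom h
      module gf = AbHom gf
      module hg = AbHom hg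
      module k = AbHom k
      module a = AbComp a
      module b = AbComp b
      module d = AbComp d

    comp-idˡ : ∀ f → AbComp (idHom (AbHom.cod f)) f f
    comp-idˡ f = record
      { composable = ≈ᴳ-refl f.cod
      ; dom≈ = ≈ᴳ-refl f.dom
      ; cod≈ = ≈ᴳ-refl f.cod
      ; fun≈ = λ p q → f.cod.trans (f.⟦⟧-cong p) q
      }
      where module f = AbHom f

    comp-idʳ : ∀ f → AbComp f (idHom (AbHom.dom f)) f
    comp-idʳ f = record
      { composable = ≈ᴳ-refl f.dom
      ; dom≈ = ≈ᴳ-refl f.dom
      ; cod≈ = ≈ᴳ-refl f.cod
      ; fun≈ = λ p q → f.⟦⟧-cong (f.dom.trans p q)
      }
      where module f = AbHom f

  Mod-Ab : Category (lsuc ℓ) ℓ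
  Mod-Ab = record
    { structure  = AbStructure
    ; isCategory = record
      { composable = AbComp.composable
      ; composite  = λ {g} {f} e → compHom g f e , comp-compHom g f e
      ; functional = λ {g} {f} {h} {h′} → comp-functional g f h h′
      ; dom-comp   = AbComp.dom≈
      ; rng-comp   = AbComp.cod≈
      ; dom-Id     = ≈ᴳ-refl
      ; rng-Id     = ≈ᴳ-refl
      ; identityˡ  = comp-idˡ
      ; identityʳ  = comp-idʳ
      ; assoc      = λ {f} {g} {h} {gf} {hg} {k} → comp-assoc f g h gf hg k
      }
    }

{-# OPTIONS --safe #-}

-- Send an object X to the Boolean group of all sets of morphisms with domain
-- X, under symmetric difference, and g : X → Y to the inverse image map along
-- f ↦ f ∘ g; being contravariant twice, this is covariant.  It is faithful
-- because the image of {h} contains Id Y only if h = g, and it is injective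
-- on objects because the union of all the sets in the group of X contains
-- Id X.

module Submission where

open import Defs
open import Level using (Level; Lift; lift; lower) renaming (suc to lsuc)
open import Axiom.ExcludedMiddle using (ExcludedMiddle)
open import Algebra.Structures using (IsAbelianGroup)
open import Data.Bool.Base using (Bool; true; false; _xor_)
open import Data.Bool.Properties
  using (⇔→≡; xor-assoc; xor-comm; xor-identityˡ; xor-identityʳ; xor-same)
open import Data.Product.Base using (Σ-syntax; _,_; proj₁; proj₂)
open import Function.Base using (id)
open import Function.Bundles using (Func; mk⇔; module Equivalence)
open import Relation.Binary.PropositionalEquality as ≡ using (_≡_)
open import Relation.Binary.Bundles using (Setoid)
open import Relation.Nullary.Decidable using (Dec; does; yes; dec-true; map′)

private variable
  ℓ : Level

-- Extensionality and membership in the cumulative hierarchy.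

≈-intro : (x y : V ℓ) → (∀ i → elt x i ∈ y) →
          (∀ j → Σ[ i ∈ Idx x ] SameElt x y i j) → x ≈ y
≈-intro (sup _ _) (sup _ _) p q = p , q

∈-respˡ : (x y z : V ℓ) → x ≈ y → y ∈ z → x ∈ z
∈-respˡ x y z e (k , q) = k , ≈-trans x y (elt z k) e q

∈-respʳ : (x y z : V ℓ) → y ≈ z → x ∈ y → x ∈ z
∈-respʳ x y z e (j , p) =
  let k , q = ≈⇒elt y z e j in k , ≈-trans x (elt y j) (elt z k) p q

elt∈ : (x : V ℓ) (i : Idx x) → elt x i ∈ x
elt∈ x i = i , ≈-refl (elt x i)

-- Subsets as characteristic functions.

record Char (s : V ℓ) : Set ℓ where
  infixl 8 _⟨_⟩
  field
    _⟨_⟩ : Idx s → Bool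
    resp : ∀ {i j} → SameElt s s i j → _⟨_⟩ i ≡ _⟨_⟩ j

open Char using (_⟨_⟩; resp)

subset : (s : V ℓ) → Char s → V ℓ
subset s φ = sup (Σ[ i ∈ Idx s ] φ ⟨ i ⟩ ≡ true) λ (i , _) → elt s i

subset-⊆ : (s : V ℓ) (φ : Char s) → subset s φ ⊆ s
subset-⊆ s φ z ((i , _) , e) = i , e

-- Boolean values keep the index type in `Set ℓ`; predicates valued in `Set ℓ` would live one level
-- too high to index a set of `V ℓ`.
2^_ : V ℓ → V ℓ
2^ s = sup (Char s) (subset s)

module _ (s t : V ℓ) where

  -- Equality of the subsets only supplies some index naming the same element; `resp` carries the
  -- value back to the index at hand.
  subset-≈⇒ : ∀ φ ψ → subset s φ ≈ subset t ψ →
              ∀ {i j} → SameElt s t i j → φ ⟨ i ⟩ ≡ ψ ⟨ j ⟩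
  subset-≈⇒ φ ψ (p , q) {i} {j} e = ⇔→≡ {z = true} (mk⇔
    (λ a → let (j₁ , b) , d = p (i , a) in
      ≡.trans (resp ψ
        (≈-trans (elt t j) (elt s i) (elt t j₁)
          (≈-sym (elt s i) (elt t j) e) d)) b)
    (λ b → let (i₁ , a) , d = q (j , b) in
      ≡.trans (resp φ
        (≈-trans (elt s i) (elt t j) (elt s i₁) e
          (≈-sym (elt s i₁) (elt t j) d))) a))

  subset-⇒≈ : s ≈ t → ∀ φ ψ →
              (∀ i j → SameElt s t i j → φ ⟨ i ⟩ ≡ ψ ⟨ j ⟩) →
              subset s φ ≈ subset t ψ
  subset-⇒≈ st φ ψ h =
    (λ (i , a) → let j , e = ≈⇒elt s t st i in
       (j , ≡.trans (≡.sym (h i j e)) a) , e) ,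
    (λ (j , b) → let i , d = ≈⇒elt t s (≈-sym s t st) j
                     e     = ≈-sym (elt t j) (elt s i) d in
       (i , ≡.trans (h i j e) b) , e)

  -- The whole of `s` is a member of `2^ s`, so it reappears as a subset of `t`.
  2^-injective-⊆ : 2^ s ≈ 2^ t → s ⊆ t
  2^-injective-⊆ (p , _) z (i , e) =
    let ψ , a , _    = p (record { _⟨_⟩ = λ _ → true ; resp = λ _ → ≡.refl })
        (j , _) , e′ = a (i , ≡.refl)
    in j , ≈-trans z (elt s i) (elt t j) e e′

  restrict : t ⊆ s → Char s → Char t
  restrict t⊆s φ = record
    { _⟨_⟩ = λ j → φ ⟨ proj₁ (inc j) ⟩
    ; resp = λ {j} {k} e →
        let i , d = inc j ; i′ , d′ = inc k in
        resp φ (≈-trans (elt s i) (elt t j) (elt s i′)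
          (≈-sym (elt t j) (elt s i) d)
          (≈-trans (elt t j) (elt t k) (elt s i′) e d′))
    }
    where
    inc : ∀ j → elt t j ∈ s
    inc j = t⊆s (elt t j) (elt∈ t j)

does-true⇒ : {A : Set ℓ} (a? : Dec A) → does a? ≡ true → A
does-true⇒ (yes a) _ = a

-- Comprehension and power sets by excluded middle.

module Classical (em : ExcludedMiddle (lsuc ℓ)) where

  decide : (P : Set ℓ) → Dec P
  decide P = map′ lower lift (em {Lift (lsuc ℓ) P})

  decide-true⇒ : (P : Set ℓ) → does (decide P) ≡ true → P
  decide-true⇒ P e = does-true⇒ (decide P) e

  true⇒decide : (P : Set ℓ) → P → does (decide P) ≡ true
  true⇒decide P = dec-true (decide P)

  comprehension : (s : V ℓ) (P : Idx s → Set ℓ) →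
                  (∀ {i j} → SameElt s s i j → P i → P j) → Char s
  comprehension s P P-resp = record
    { _⟨_⟩ = λ i → does (decide (P i))
    ; resp = λ {i} {j} e → ⇔→≡ {z = true} (mk⇔
        (λ a → true⇒decide (P j) (P-resp e (decide-true⇒ (P i) a)))
        (λ b → true⇒decide (P i)
          (P-resp (≈-sym (elt s i) (elt s j) e) (decide-true⇒ (P j) b))))
    }

  -- For an arbitrary subset `z`, deciding membership in `z` produces its characteristic function.
  2^-isPowerSet : (s : V ℓ) → IsPowerSet (2^ s) s
  2^-isPowerSet s z = mk⇔
    (λ (φ , e) y y∈z → subset-⊆ s φ y (∈-respʳ y z (subset s φ) e y∈z))
    (λ z⊆s →
      let χ = comprehension s (λ i → elt s i ∈ z)
                λ {i} {j} e → ∈-respˡ (elt s j) (elt s i) z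
                                (≈-sym (elt s i) (elt s j) e)
      in χ , ≈-intro z (subset s χ)
        (λ k → let i , e = z⊆s (elt z k) (elt∈ z k) in
          (i , true⇒decide _ (k , ≈-sym (elt z k) (elt s i) e)) , e)
        (λ (i , a) → let k , e = decide-true⇒ (elt s i ∈ z) a in
          k , ≈-sym (elt s i) (elt z k) e))

powerSet-unique : (p q x : V ℓ) → IsPowerSet p x → IsPowerSet q x → p ≈ q
powerSet-unique p q x P Q = ≈-intro p q
  (λ i → Equivalence.from (Q (elt p i))
           (Equivalence.to (P (elt p i)) (elt∈ p i)))
  (λ j → let i , e = Equivalence.from (P (elt q j))
                       (Equivalence.to (Q (elt q j)) (elt∈ q j))
         in i , ≈-sym (elt q j) (elt p i) e)

-- Closure properties of the universe.

module Universe (em : ExcludedMiddle (lsuc ℓ))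
                (𝔘 : V ℓ) (U : IsGrothendieckUniverse 𝔘) where
  open IsGrothendieckUniverse U
  open Classical em

  -- Such an `x` is a member of the power set of `s`, which lies in the transitive set `𝔘`.
  subset∈𝔘 : (s : V ℓ) → s ∈ 𝔘 → (x : V ℓ) → x ⊆ s → x ∈ 𝔘
  subset∈𝔘 s s∈𝔘 x x⊆s =
    let p , P , p∈𝔘 = power s s∈𝔘 in
    transitive p p∈𝔘 x (Equivalence.from (P x) x⊆s)

  -- The universe provides some power set of `s`; by uniqueness it is the same set as `2^ s`.
  2^∈𝔘 : (s : V ℓ) → s ∈ 𝔘 → 2^ s ∈ 𝔘
  2^∈𝔘 s s∈𝔘 =
    let p , P , p∈𝔘 = power s s∈𝔘 in
    ∈-respˡ (2^ s) p 𝔘 (powerSet-unique (2^ s) p s (2^-isPowerSet s) P) p∈𝔘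

  -- Boolean groups under symmetric difference, and inverse images.

  module _ {s : V ℓ} where

    _△_ : Char s → Char s → Char s
    φ △ ψ = record
      { _⟨_⟩ = λ i → φ ⟨ i ⟩ xor ψ ⟨ i ⟩
      ; resp = λ e → ≡.cong₂ _xor_ (resp φ e) (resp ψ e)
      }

    ∅ᶜ : Char s
    ∅ᶜ = record { _⟨_⟩ = λ _ → false ; resp = λ _ → ≡.refl }

    pointwise : ∀ φ ψ → (∀ i → φ ⟨ i ⟩ ≡ ψ ⟨ i ⟩) →
                SameElt (2^ s) (2^ s) φ ψ
    pointwise φ ψ h = subset-⇒≈ s s (≈-refl s) φ ψ
      λ i j e → ≡.trans (h i) (resp ψ e)

  △-cong : (s t : V ℓ) → s ≈ t → ∀ {φ φ′ ψ ψ′} →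
           SameElt (2^ s) (2^ t) φ φ′ → SameElt (2^ s) (2^ t) ψ ψ′ →
           SameElt (2^ s) (2^ t) (φ △ ψ) (φ′ △ ψ′)
  △-cong s t st {φ} {φ′} {ψ} {ψ′} p q =
    subset-⇒≈ s t st (φ △ ψ) (φ′ △ ψ′) λ i j e → ≡.cong₂ _xor_
      (subset-≈⇒ s t φ φ′ p e) (subset-≈⇒ s t ψ ψ′ q e)

  △-isAbelianGroup : (s : V ℓ) →
                     IsAbelianGroup (SameElt (2^ s) (2^ s)) _△_ ∅ᶜ id
  △-isAbelianGroup s = record
    { isGroup = record
      { isMonoid = record
        { isSemigroup = record
          { isMagma = record
            { isEquivalence = Setoid.isEquivalence (El (2^ s))
            ; ∙-cong = λ {φ} {φ′} {ψ} {ψ′} →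
                △-cong s s (≈-refl s) {φ} {φ′} {ψ} {ψ′}
            }
          ; assoc = λ φ ψ χ → pointwise ((φ △ ψ) △ χ) (φ △ (ψ △ χ))
              λ i → xor-assoc (φ ⟨ i ⟩) (ψ ⟨ i ⟩) (χ ⟨ i ⟩)
          }
        ; identity =
            (λ φ → pointwise (∅ᶜ △ φ) φ λ i → xor-identityˡ (φ ⟨ i ⟩)) ,
            (λ φ → pointwise (φ △ ∅ᶜ) φ λ i → xor-identityʳ (φ ⟨ i ⟩))
        }
      ; inverse =
          (λ φ → pointwise (φ △ φ) ∅ᶜ λ i → xor-same (φ ⟨ i ⟩)) ,
          (λ φ → pointwise (φ △ φ) ∅ᶜ λ i → xor-same (φ ⟨ i ⟩))
      ; ⁻¹-cong = id
      }
    ; comm = λ φ ψ → pointwise (φ △ ψ) (ψ △ φ)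
        λ i → xor-comm (φ ⟨ i ⟩) (ψ ⟨ i ⟩)
    }

  powerGroup : (s : V ℓ) → s ∈ 𝔘 → AbGroup 𝔘
  powerGroup s s∈𝔘 = record
    { set            = 2^ s
    ; set∈𝔘          = 2^∈𝔘 s s∈𝔘
    ; _+_            = _△_
    ; 0#             = ∅ᶜ
    ; -_             = id
    ; isAbelianGroup = △-isAbelianGroup s
    }

  -- Objects are compared as tuples, so the carriers must be equal sets: having the same subsets as
  -- `s`, `t` makes `2^ t` a power set of `s`, and power sets are unique.
  powerGroup-cong : (s t : V ℓ) (s∈𝔘 : s ∈ 𝔘) (t∈𝔘 : t ∈ 𝔘) → s ≈ t →
                    _≈ᴳ_ 𝔘 (powerGroup s s∈𝔘) (powerGroup t t∈𝔘)
  powerGroup-cong s t _ _ st = record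
    { set≈ = powerSet-unique (2^ s) (2^ t) s (2^-isPowerSet s) λ z → mk⇔
        (λ z∈ y y∈z → ∈-respʳ y t s (≈-sym s t st)
          (Equivalence.to (2^-isPowerSet t z) z∈ y y∈z))
        (λ z⊆s → Equivalence.from (2^-isPowerSet t z)
          λ y y∈z → ∈-respʳ y s t st (z⊆s y y∈z))
    ; +≈   = λ {φ} {φ′} {ψ} {ψ′} → △-cong s t st {φ} {φ′} {ψ} {ψ′}
    ; -≈   = id
    ; 0≈   = subset-⇒≈ s t st ∅ᶜ ∅ᶜ λ _ _ _ → ≡.refl
    }

  inverseImage : (s t : V ℓ) (s∈𝔘 : s ∈ 𝔘) (t∈𝔘 : t ∈ 𝔘) →
                 Func (El s) (El t) → AbHom 𝔘
  inverseImage s t s∈𝔘 t∈𝔘 α = record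
    { dom   = powerGroup t t∈𝔘
    ; cod   = powerGroup s s∈𝔘
    ; fun   = _⋆
    ; isHom = record
      { isMonoidHomomorphism = record
        { isMagmaHomomorphism = record
          { isRelHomomorphism = record
            { cong = λ {φ} {ψ} p → pointwise (φ ⋆) (ψ ⋆)
                λ i → subset-≈⇒ t t φ ψ p (≈-refl (elt t (Func.to α i)))
            }
          ; homo = λ φ ψ → pointwise ((φ △ ψ) ⋆) ((φ ⋆) △ (ψ ⋆))
              λ _ → ≡.refl
          }
        ; ε-homo = pointwise (∅ᶜ ⋆) ∅ᶜ λ _ → ≡.refl
        }
      ; ⁻¹-homo = λ φ → pointwise (φ ⋆) (φ ⋆) λ _ → ≡.refl
      }
    }
    where
    _⋆ : Char t → Char s
    φ ⋆ = record
      { _⟨_⟩ = λ i → φ ⟨ Func.to α i ⟩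
      ; resp = λ e → resp φ (Func.cong α e)
      }

  -- Coslices and the functor to Abelian groups.

  module _ (C : SmallCategory 𝔘) where
    open SmallCategory C using (obj; mor; mor∈𝔘; category)
    open Category category

    coslice : Obj.Carrier → V ℓ
    coslice x = sup (Σ[ f ∈ Mor.Carrier ] dom₀ f Obj.≈ x)
                    λ (f , _) → elt mor f

    coslice-⊆ : ∀ x → coslice x ⊆ mor
    coslice-⊆ x z ((f , _) , e) = f , e

    coslice∈𝔘 : ∀ x → coslice x ∈ 𝔘
    coslice∈𝔘 x = subset∈𝔘 mor mor∈𝔘 (coslice x) (coslice-⊆ x)

    coslice-cong : ∀ {x y} → x Obj.≈ y → coslice x ≈ coslice y
    coslice-cong e =
      (λ (f , p) → (f , Obj.trans p e) , Mor.refl {f}) ,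
      (λ (f , p) → (f , Obj.trans p (Obj.sym e)) , Mor.refl {f})

    -- The identity of `x` has domain `x`, and as a member of `coslice y` it also has domain `y`.
    coslice-injective : ∀ {x y} → coslice x ⊆ coslice y → x Obj.≈ y
    coslice-injective {x} {y} x⊆y =
      let (f , p) , e = x⊆y (elt mor (Id₀ x)) ((Id₀ x , dom-Id x) , Mor.refl {Id₀ x})
      in Obj.trans (Obj.sym (dom-Id x)) (Obj.trans (dom-cong e) p)

    -- Composition is given only by its graph; this makes chosen composites respect equality of
    -- their factors.
    comp-unique : ∀ {g g′ f f′ h h′} → g Mor.≈ g′ → f Mor.≈ f′ →
                  Comp g f h → Comp g′ f′ h′ → h Mor.≈ h′
    comp-unique {h = h} p q c d =
      functional (Comp-resp p q (Mor.refl {h}) c) d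

    precompose : ∀ g → Func (El (coslice (rng₀ g))) (El (coslice (dom₀ g)))
    precompose g = record
      { to   = λ (f , p) → let h , c = composite (Obj.sym p) in
                 h , dom-comp c
      ; cong = λ {(f , p)} {(f′ , p′)} e →
          comp-unique e (Mor.refl {g}) (proj₂ (composite (Obj.sym p)))
                                       (proj₂ (composite (Obj.sym p′)))
      }

    F₀ : Obj.Carrier → AbGroup 𝔘
    F₀ x = powerGroup (coslice x) (coslice∈𝔘 x)

    F₁ : Mor.Carrier → AbHom 𝔘
    F₁ g = inverseImage (coslice (rng₀ g)) (coslice (dom₀ g))
             (coslice∈𝔘 (rng₀ g)) (coslice∈𝔘 (dom₀ g)) (precompose g)

    private
      _·_ : (f : AbHom 𝔘) → Idx (AbHom.dom.set f) → Idx (AbHom.cod.set f)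
      _·_ = AbHom.fun

    F₀-cong : ∀ {x y} → x Obj.≈ y → _≈ᴳ_ 𝔘 (F₀ x) (F₀ y)
    F₀-cong {x} {y} e = powerGroup-cong (coslice x) (coslice y)
      (coslice∈𝔘 x) (coslice∈𝔘 y) (coslice-cong e)

    F₀-injective : ∀ {x y} → _≈ᴳ_ 𝔘 (F₀ x) (F₀ y) → x Obj.≈ y
    F₀-injective {x} {y} e = coslice-injective
      (2^-injective-⊆ (coslice x) (coslice y) (_≈ᴳ_.set≈ e))

    F₁-cong : ∀ {g h} → g Mor.≈ h → _≈ᴹ_ 𝔘 (F₁ g) (F₁ h)
    F₁-cong {g} {h} e = record
      { dom≈ = F₀-cong (dom-cong e)
      ; cod≈ = F₀-cong (rng-cong e)
      ; fun≈ = λ {φ} {ψ} p →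
          subset-⇒≈ (coslice (rng₀ g)) (coslice (rng₀ h))
            (coslice-cong (rng-cong e))
            (F₁ g · φ) (F₁ h · ψ)
            λ (k , q) (k′ , q′) d →
              subset-≈⇒ (coslice (dom₀ g)) (coslice (dom₀ h)) φ ψ p
                (comp-unique d e (proj₂ (composite (Obj.sym q)))
                                 (proj₂ (composite (Obj.sym q′))))
      }

    F-Id : ∀ x → _≈ᴹ_ 𝔘 (F₁ (Id₀ x)) (idHom 𝔘 (F₀ x))
    F-Id x = record
      { dom≈ = F₀-cong (dom-Id x)
      ; cod≈ = F₀-cong (rng-Id x)
      ; fun≈ = λ {φ} {ψ} p →
          subset-⇒≈ (coslice (rng₀ (Id₀ x))) (coslice x)
            (coslice-cong (rng-Id x)) (F₁ (Id₀ x) · φ) ψ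
            λ (k , q) (k′ , q′) d →
              subset-≈⇒ (coslice (dom₀ (Id₀ x))) (coslice x) φ ψ p
                -- As `k′` has domain `x`, the right unit law identifies the chosen composite of `k`
                -- after `Id₀ x` with `k′`.
                (comp-unique d (Id-cong (Obj.sym q′))
                  (proj₂ (composite (Obj.sym q))) (identityʳ k′))
      }

    F-Comp : ∀ {g f h} → Comp g f h → AbComp 𝔘 (F₁ g) (F₁ f) (F₁ h)
    F-Comp {g} {f} {h} c = record
      { composable = F₀-cong (composable c)
      ; dom≈ = F₀-cong (dom-comp c)
      ; cod≈ = F₀-cong (rng-comp c)
      ; fun≈ = λ {φ} {ψ} {χ} p r →
          subset-⇒≈ (coslice (rng₀ h)) (coslice (rng₀ g))
            (coslice-cong (rng-comp c))
            (F₁ h · φ) (F₁ g · χ)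
            λ (k , q) (k′ , q′) d →
              -- With `h` the composite of `g` after `f`, associativity gives
              -- `k ∘ h = (k′ ∘ g) ∘ f`. The values then agree in the order `φ` at `kh`, `ψ` at
              -- `k′gf`, `χ` at `k′g`.
              let kh   , a  = composite (Obj.sym q)
                  k′g  , b  = composite (Obj.sym q′)
                  s         = Obj.trans (dom-comp b) (Obj.sym (composable c))
                  -- The proof `s` also appears in the index `k′g , s` below, so `F₁ f · ψ`
                  -- evaluated there unfolds to `ψ` at exactly this composite.
                  k′gf , b′ = composite (Obj.sym s)
                  a′        = assoc c b (Comp-resp d (Mor.refl {h}) (Mor.refl {kh}) a)
              in ≡.trans
                (subset-≈⇒ (coslice (dom₀ h)) (coslice (dom₀ f)) φ ψ p
                  {kh , dom-comp a} {k′gf , dom-comp b′} (functional a′ b′))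
                (subset-≈⇒ (coslice (rng₀ f)) (coslice (dom₀ g)) (F₁ f · ψ) χ r
                  {k′g , s} {k′g , dom-comp b} (Mor.refl {k′g}))
      }

    -- Faithfulness and the embedding.

    singleton : Mor.Carrier → Char mor
    singleton g = comprehension mor (g Mor.≈_) λ {i} {j} e p →
      Mor.trans {g} {i} {j} p e

    -- Both homomorphisms are applied to the singleton of `g`, and the resulting sets are tested for
    -- containing the identity of the common range.
    F₁-injective : ∀ {g h} → _≈ᴹ_ 𝔘 (F₁ g) (F₁ h) → g Mor.≈ h
    F₁-injective {g} {h} e =
      let rng≈ = F₀-injective (_≈ᴹ_.cod≈ e)
          dom≈ = F₀-injective (_≈ᴹ_.dom≈ e)
          -- One and the same singleton is cut down to two coslices that are equal by `dom≈`, so the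
          -- homomorphisms receive equal arguments.
          φ    = restrict mor (coslice (dom₀ g)) (coslice-⊆ (dom₀ g))
                   (singleton g)
          ψ    = restrict mor (coslice (dom₀ h)) (coslice-⊆ (dom₀ h))
                   (singleton g)
          φ≈ψ  = subset-⇒≈ (coslice (dom₀ g)) (coslice (dom₀ h))
                   (coslice-cong dom≈) φ ψ
                   λ _ _ → resp (singleton g)
          i    = Id₀ (rng₀ g)
          j    = Id₀ (rng₀ h)
          k , a = composite (Obj.sym (dom-Id (rng₀ g)))
          k′ , b = composite (Obj.sym (dom-Id (rng₀ h)))
          -- At the identities, the two sides decide `g Mor.≈ k` and `g Mor.≈ k′`, where `k` and
          -- `k′` are the composites of `g` and `h` with the identities of their ranges. The left
          -- unit law makes the first true, hence the second, and also identifies `k′` with `h`.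
          eq   = subset-≈⇒ (coslice (rng₀ g)) (coslice (rng₀ h))
                   (F₁ g · φ) (F₁ h · ψ) (_≈ᴹ_.fun≈ e {φ} {ψ} φ≈ψ)
                   {i , dom-Id (rng₀ g)} {j , dom-Id (rng₀ h)}
                   (Id-cong rng≈)
          g≈k′ = decide-true⇒ (g Mor.≈ k′)
                   (≡.trans (≡.sym eq)
                     (true⇒decide (g Mor.≈ k) (functional (identityˡ g) a)))
      in Mor.trans {g} {k′} {h} g≈k′ (functional b (identityˡ h))

    embedding : Embedding category (Mod-Ab 𝔘)
    embedding = record
      { functor = record
        { onObj  = record { to = F₀ ; cong = F₀-cong }
        ; onMor  = record { to = F₁ ; cong = F₁-cong }
        ; F-dom  = λ g → ≈ᴳ-refl 𝔘 (F₀ (dom₀ g))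
        ; F-rng  = λ g → ≈ᴳ-refl 𝔘 (F₀ (rng₀ g))
        ; F-Id   = F-Id
        ; F-Comp = F-Comp
        }
      ; F₀-injective = F₀-injective
      ; F₁-injective = F₁-injective
      }

corollary1p3 : ∀ {ℓ : Level} → ExcludedMiddle (lsuc ℓ) →
    (𝔘 : V ℓ) → IsGrothendieckUniverse 𝔘 → Universal 𝔘 (Mod-Ab 𝔘)
corollary1p3 em 𝔘 U C _ = Universe.embedding em 𝔘 U C
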